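{- Let $f:2^{[n]}\to\mathbb{R}_+$ be a non-increasing weakly-$\alpha$-supermodular set function, let $k$ be a positive integer, and let $S^*$ be an optimal solution of $\min\{f(S): S\subseteq[n],\ |S|\le k\}$. Let $\rho\ge 1$ and let $S_0\subseteq[n]$ (produced by a $\rho$-approximation algorithm) satisfy $f(S_0)\le\rho f(S^*)$. Let $0<\varepsilon\le\rho$. Then there is an algorithm, namely greedy extension of $S_0$ by $\lceil \alpha k\ln(\rho/\varepsilon)\rceil$ steps, that generates a set $S\supseteq S_0$ such that $$|S|\le|S_0|+\left\lceil \alpha k\ln\frac{\rho}{\varepsilon}\right\rceil\qquad\text{and}\qquad f(S)\le(1+\varepsilon)f(S^*).$$
   Context: $[n]=\{1,\dots,n\}$ and $\mathbb{R}_+$ is the set of non-negative reals. A set function $f:2^{[n]}\to\mathbb{R}_+$ is non-increasing if $f(S\cup T)\le f(S)$ for all $S,T\subseteq[n]$. A non-negative non-increasing set function $f$ is weakly-$\alpha$-supermodular, where $\alpha\ge 1$, if for all $S,T\subseteq[n]$ $$f(S)-f(S\cup T)\le \alpha\cdot|T\setminus S|\cdot\max_{i\in T\setminus S}[f(S)-f(S\cup\{i\})],$$ where the right-hand side is read as $0$ when $T\setminus S=\emptyset$. Greedy extension of $S_0$ by $\tau$ steps: for $t=1,\dots,\tau$ set $S_t=S_{t-1}\cup\{i_t\}$, where $i_t$ is any element of $\arg\min_{i\in[n]} f(S_{t-1}\cup\{i\})$; output $S_\tau$. -}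

module Defs where

open import Algebra.Bundles using (CommutativeRing; Semiring)
import Algebra.Definitions.RawSemiring as RawSemiringOps
open import Algebra.Structures using (IsCommutativeRing)
open import Axiom.ExcludedMiddle using (ExcludedMiddle)
open import Data.Fin.Base using (Fin)
open import Data.Fin.Subset as Subset using (Subset; _∪_; _─_; ⁅_⁆)
open import Data.Fin.Subset.Properties using (_∈?_)
open import Data.List.Base using (List; []; _∷_; allFin; filter; map)
import Data.List.Extrema as Extrema
open import Data.Nat.Base as ℕ using (ℕ; suc)
open import Data.Product.Base using (∃; _×_; proj₁)
open import Level using (0ℓ)
open import Relation.Binary.Bundles using (TotalOrder)
import Relation.Binary.Construct.NonStrictToStrict as ToStrict
open import Relation.Binary.Core using (Rel)
open import Relation.Binary.Structures using (IsTotalOrder)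
open import Relation.Nullary.Decidable.Core using (yes; no)
open import Relation.Nullary.Negation.Core using (¬_)
open import Relation.Unary using (Pred)

-- The real numbers, axiomatised as a Dedekind-complete ordered field.  The
-- carrier is a setoid, so that concrete constructions qualify as models.
record Reals : Set₁ where
  infix  4 _≈_ _≤_
  infixl 6 _+_
  infixl 7 _*_
  infix  8 -_
  infix  9 _⁻¹
  field
    Carrier : Set
    _≈_ _≤_ : Rel Carrier 0ℓ
    _+_ _*_ : Carrier → Carrier → Carrier
    -_      : Carrier → Carrier
    0# 1#   : Carrier
    -- The value of the inverse at zero is unspecified.
    _⁻¹     : Carrier → Carrier

    isCommutativeRing : IsCommutativeRing _≈_ _+_ _*_ -_ 0# 1#
    0≉1               : ¬ (0# ≈ 1#)
    ⁻¹-inverseʳ       : ∀ x → ¬ (x ≈ 0#) → x * x ⁻¹ ≈ 1#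
    isTotalOrder      : IsTotalOrder _≈_ _≤_
    +-monoˡ-≤         : ∀ z {x y} → x ≤ y → x + z ≤ y + z
    *-nonneg          : ∀ {x y} → 0# ≤ x → 0# ≤ y → 0# ≤ x * y

  UpperBound : Pred Carrier 0ℓ → Carrier → Set
  UpperBound P u = ∀ x → P x → x ≤ u

  field
    supremum : (P : Pred Carrier 0ℓ) → ∃ P → ∃ (UpperBound P) →
               ∃ λ s → UpperBound P s × (∀ u → UpperBound P u → s ≤ u)

  commutativeRing : CommutativeRing 0ℓ 0ℓ
  commutativeRing = record { isCommutativeRing = isCommutativeRing }

  totalOrder : TotalOrder 0ℓ 0ℓ 0ℓ
  totalOrder = record { isTotalOrder = isTotalOrder }

  open CommutativeRing commutativeRing public using (_-_)
  open ToStrict _≈_ _≤_ public using (_<_)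
  open Extrema totalOrder using (max)
  private
    module Ops = RawSemiringOps
      (Semiring.rawSemiring (CommutativeRing.semiring commutativeRing))
  open Ops public using (_^_)

  infixl 7 _/_
  _/_ : Carrier → Carrier → Carrier
  x / y = x * y ⁻¹

  fromℕ : ℕ → Carrier
  fromℕ n = n Ops.× 1#

  -- By convention zero on the empty list.
  maximum : List Carrier → Carrier
  maximum []       = 0#
  maximum (x ∷ xs) = max x xs

  ConvergesTo : (ℕ → Carrier) → Carrier → Set
  ConvergesTo u l = ∀ δ → 0# < δ →
    ∃ λ N → ∀ n → N ℕ.≤ n → (- δ < u n - l) × (u n - l < δ)

  -- z = eʸ, with eʸ = lim (1 + y/n)ⁿ.
  IsExp : Carrier → Carrier → Set
  IsExp y z = ConvergesTo (λ n → (1# + y / fromℕ n) ^ n) z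

  IsCeiling : Carrier → ℕ → Set
  IsCeiling x m = x ≤ fromℕ m × (∀ m′ → x ≤ fromℕ m′ → m ℕ.≤ m′)

module _ (em : ExcludedMiddle 0ℓ) where

  -- Definite description: an element satisfying P, or the given default if
  -- there is none.
  the : {A : Set} → Pred A 0ℓ → A → A
  the P default with em {∃ P}
  ... | yes p = proj₁ p
  ... | no  _ = default

  module RealFunctions (ℝ : Reals) where
    open Reals ℝ

    -- The inverse of the exponential; 0 outside the positive reals.
    ln : Carrier → Carrier
    ln x = the (λ y → IsExp y x) 0#

    -- The least natural number above x, i.e. the usual ceiling for x ≥ 0.
    ⌈_⌉ : Carrier → ℕ
    ⌈ x ⌉ = the (IsCeiling x) 0

module SetFunctions (ℝ : Reals) where
  open Reals ℝ

  SetFunction : ℕ → Set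
  SetFunction n = Subset n → Carrier

  module _ {n : ℕ} where

    NonNegative : SetFunction n → Set
    NonNegative f = ∀ S → 0# ≤ f S

    NonIncreasing : SetFunction n → Set
    NonIncreasing f = ∀ S T → f (S ∪ T) ≤ f S

    elements : Subset n → List (Fin n)
    elements S = filter (_∈? S) (allFin n)

    WeaklySupermodular : Carrier → SetFunction n → Set
    WeaklySupermodular α f = ∀ S T →
      f S - f (S ∪ T) ≤
        α * fromℕ Subset.∣ T ─ S ∣
          * maximum (map (λ i → f S - f (S ∪ ⁅ i ⁆)) (elements (T ─ S)))

    IsOptimal : SetFunction n → ℕ → Subset n → Set
    IsOptimal f k S* =
      Subset.∣ S* ∣ ℕ.≤ k × (∀ S → Subset.∣ S ∣ ℕ.≤ k → f S* ≤ f S)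

    IsArgMin : (Fin n → Carrier) → Fin n → Set
    IsArgMin g i = ∀ j → g i ≤ g j

    -- GreedyExtension f S₀ t S: some run of t greedy steps, with ties broken
    -- arbitrarily, leads from S₀ to S.
    data GreedyExtension (f : SetFunction n) (S₀ : Subset n) :
                         ℕ → Subset n → Set where
      start : GreedyExtension f S₀ 0 S₀
      step  : ∀ {t S} → GreedyExtension f S₀ t S →
              (i : Fin n) → IsArgMin (λ j → f (S ∪ ⁅ j ⁆)) i →
              GreedyExtension f S₀ (suc t) (S ∪ ⁅ i ⁆)

{-# OPTIONS --safe #-}
-- Let c = αk and u = 1/c.  Weak supermodularity tested against S* gives
-- d ≤ c (d − d′) for consecutive values of d = f(S) − f(S*) along a greedy run,
-- so d shrinks by the factor 1 − u at every step, and the theorem reduces to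
-- x (1 − u)^τ ≤ 1 where x = ρ/ε and τ ≥ c ln x.  By Bernoulli's inequality,
-- (1 + τu/m)^m ≤ ((1 + u/m)^m)^τ and (1 + u/m)^m (1 − u) ≤ 1; as ln x ≤ τu and
-- (1 + (ln x)/m)^m tends to x, the bound follows without any calculus.  The
-- logarithm of x ≥ 1 is the supremum of all y ≥ 0 such that (1 + y/m)^m ≤ x for
-- every m ≥ 1; it works because these powers increase with m and satisfy
-- (1 + (y + η)/m)^m (1 − η) ≤ (1 + y/m)^m.
module Submission where

open import Defs
open import Algebra.Bundles using (CommutativeRing)
import Algebra.Properties.CommutativeSemiring.Exp as Exp
import Algebra.Properties.Ring as RingProperties
import Algebra.Properties.Semiring.Mult.TCOptimised as Mult
import Algebra.Solver.Ring as RingSolver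
open import Algebra.Solver.Ring.AlmostCommutativeRing
  using (fromCommutativeRing; _-Raw-AlmostCommutative⟶_)
open import Axiom.ExcludedMiddle using (ExcludedMiddle)
open import Data.Empty using (⊥-elim)
open import Data.Fin.Base using (Fin; fromℕ<)
open import Data.Fin.Subset using (Subset; inside; outside; _⊆_; ∣_∣; _∪_; _─_; ⁅_⁆)
open import Data.Fin.Subset.Properties
  using (∪-comm; p⊆p∪q; ⊆-refl; ⊆-trans; ∣p─q∣≤∣p∣; ∣⁅x⁆∣≡1; ∣p∣≤∣x∷p∣)
open import Data.Integer.Base as ℤ using (ℤ; +_; -[1+_])
import Data.Integer.Properties as ℤ
open import Data.List.Base using (List; []; _∷_; allFin; map)
import Data.List.Extrema as Extrema
open import Data.List.Membership.Propositional.Properties using (∈-allFin)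
open import Data.List.Relation.Unary.All as All using (All; []; _∷_)
import Data.List.Relation.Unary.All.Properties as All
open import Data.Maybe.Base as Maybe using (Maybe)
open import Data.Nat.Base as ℕ using (ℕ; zero; suc; NonZero)
open import Data.Nat.Induction using (<-rec)
import Data.Nat.Properties as ℕ
open import Data.Product.Base using (∃; _×_; _,_; proj₁; proj₂)
open import Data.Sum.Base using (inj₁; inj₂)
open import Data.Vec.Base using ([]; _∷_)
open import Level using (0ℓ)
open import Relation.Binary.Bundles using (TotalOrder)
open import Relation.Binary.PropositionalEquality as ≡ using (_≡_)
import Relation.Binary.Reasoning.PartialOrder as PosetReasoning
import Relation.Binary.Reasoning.Setoid as SetoidReasoning
open import Relation.Nullary.Decidable.Core using (yes; no; dec⇒maybe)
open import Relation.Nullary.Negation.Core using (¬_)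
open import Relation.Unary using (Pred)

-- Integer coefficients for ring normalisation.

-- The ring solver needs coefficients whose equality computes in order to cancel
-- x − x; equality in an abstract ring does not.
module ℤ-Coefficients (R : CommutativeRing 0ℓ 0ℓ) where
  open CommutativeRing R hiding (zero)
  open RingProperties ring using (-0#≈0#; -‿involutive; -‿distribˡ-*; -‿distribʳ-*; -‿+-comm)
  open Mult semiring using (1+×; ×-homo-+; ×1-homo-*) renaming (_×_ to _·_)
  open SetoidReasoning setoid

  -- The optimised multiple makes `⟦ + 1 ⟧` reduce to `1#` itself, so `con (+ 1)` in a solver
  -- equation matches a literal `1#` in the goal.
  ⟦_⟧ : ℤ → Carrier
  ⟦ + n ⟧      = n · 1#
  ⟦ -[1+ n ] ⟧ = - (suc n · 1#)

  [z+x]-[z+y]≈x-y : ∀ x y z → (z + x) - (z + y) ≈ x - y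
  [z+x]-[z+y]≈x-y x y z = begin
    (z + x) - (z + y)      ≈⟨ +-cong (+-comm z x) (sym (-‿+-comm z y)) ⟩
    (x + z) + (- z + - y)  ≈⟨ +-assoc x z _ ⟩
    x + (z + (- z + - y))  ≈⟨ +-congˡ (+-assoc z (- z) (- y)) ⟨
    x + ((z - z) + - y)    ≈⟨ +-congˡ (+-congʳ (-‿inverseʳ z)) ⟩
    x + (0# + - y)         ≈⟨ +-congˡ (+-identityˡ (- y)) ⟩
    x - y                  ∎

  -- Stripping one successor from each argument removes a common `1#` from the difference. This
  -- settles the mixed-sign cases of `+-homo`.
  ⟦⊖⟧ : ∀ m n → ⟦ m ℤ.⊖ n ⟧ ≈ m · 1# - n · 1#
  ⟦⊖⟧ m       zero    = sym (trans (+-congˡ -0#≈0#) (+-identityʳ _))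
  ⟦⊖⟧ zero    (suc n) = sym (+-identityˡ _)
  ⟦⊖⟧ (suc m) (suc n) = begin
    ⟦ suc m ℤ.⊖ suc n ⟧              ≡⟨ ≡.cong ⟦_⟧ (ℤ.[1+m]⊖[1+n]≡m⊖n m n) ⟩
    ⟦ m ℤ.⊖ n ⟧                      ≈⟨ ⟦⊖⟧ m n ⟩
    m · 1# - n · 1#                  ≈⟨ [z+x]-[z+y]≈x-y _ _ 1# ⟨
    (1# + m · 1#) - (1# + n · 1#)    ≈⟨ +-cong (1+× m 1#) (-‿cong (1+× n 1#)) ⟨
    suc m · 1# - suc n · 1#          ∎

  -‿homo : ∀ i → ⟦ ℤ.- i ⟧ ≈ - ⟦ i ⟧
  -‿homo (+ zero)   = sym -0#≈0#
  -‿homo (+ suc n)  = refl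
  -‿homo -[1+ n ]   = sym (-‿involutive _)

  +-homo : ∀ i j → ⟦ i ℤ.+ j ⟧ ≈ ⟦ i ⟧ + ⟦ j ⟧
  +-homo (+ m)    (+ n)    = ×-homo-+ 1# m n
  +-homo (+ m)    -[1+ n ] = ⟦⊖⟧ m (suc n)
  +-homo -[1+ m ] (+ n)    = trans (⟦⊖⟧ n (suc m)) (+-comm _ _)
  +-homo -[1+ m ] -[1+ n ] = begin
    - (suc (suc (m ℕ.+ n)) · 1#)        ≡⟨ ≡.cong (λ l → - (suc l · 1#)) (ℕ.+-suc m n) ⟨
    - ((suc m ℕ.+ suc n) · 1#)          ≈⟨ -‿cong (×-homo-+ 1# (suc m) (suc n)) ⟩
    - (suc m · 1# + suc n · 1#)         ≈⟨ -‿+-comm _ _ ⟨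
    - (suc m · 1#) + - (suc n · 1#)     ∎

  -‿*-homo : ∀ m n → ⟦ ℤ.- (+ (m ℕ.* n)) ⟧ ≈ - (m · 1# * n · 1#)
  -‿*-homo m n = trans (-‿homo (+ (m ℕ.* n))) (-‿cong (×1-homo-* m n))

  *-homo : ∀ i j → ⟦ i ℤ.* j ⟧ ≈ ⟦ i ⟧ * ⟦ j ⟧
  *-homo (+ m) (+ n) rewrite ℤ.+◃n≡+n (m ℕ.* n) = ×1-homo-* m n
  *-homo (+ m) -[1+ n ] rewrite ℤ.-◃n≡-n (m ℕ.* suc n) =
    trans (-‿*-homo m (suc n)) (-‿distribʳ-* _ _)
  *-homo -[1+ m ] (+ n) rewrite ℤ.-◃n≡-n (suc m ℕ.* n) =
    trans (-‿*-homo (suc m) n) (-‿distribˡ-* _ _)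
  *-homo -[1+ m ] -[1+ n ] rewrite ℤ.+◃n≡+n (suc m ℕ.* suc n) = begin
    (suc m ℕ.* suc n) · 1#                  ≈⟨ ×1-homo-* (suc m) (suc n) ⟩
    suc m · 1# * suc n · 1#                 ≈⟨ -‿involutive _ ⟨
    - - (suc m · 1# * suc n · 1#)           ≈⟨ -‿cong (-‿distribˡ-* _ _) ⟩
    - (- (suc m · 1#) * suc n · 1#)         ≈⟨ -‿distribʳ-* _ _ ⟩
    - (suc m · 1#) * - (suc n · 1#)         ∎

  homomorphism : ℤ.+-*-rawRing -Raw-AlmostCommutative⟶ fromCommutativeRing R
  homomorphism = record
    { ⟦_⟧    = ⟦_⟧
    ; +-homo = +-homo
    ; *-homo = *-homo
    ; -‿homo = -‿homo
    ; 0-homo = refl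
    ; 1-homo = refl
    }

  _coeff≟_ : ∀ i j → Maybe (⟦ i ⟧ ≈ ⟦ j ⟧)
  i coeff≟ j = Maybe.map (λ i≡j → reflexive (≡.cong ⟦_⟧ i≡j)) (dec⇒maybe (i ℤ.≟ j))

  open RingSolver ℤ.+-*-rawRing (fromCommutativeRing R) homomorphism _coeff≟_ public
    using (solve; _:=_; _:+_; _:*_; _:-_; :-_; con)

-- Arithmetic of an ordered field.

module OrderedField (em : ExcludedMiddle 0ℓ) (ℝ : Reals) where
  open Reals ℝ
  open CommutativeRing commutativeRing
    using (refl; sym; trans; +-cong; +-congˡ; +-congʳ; +-comm; +-identityʳ; -‿cong; -‿inverseʳ;
           *-congˡ; *-congʳ; *-comm; *-assoc; *-identityˡ; *-identityʳ; zeroˡ; zeroʳ; commutativeSemiring)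
  open ℤ-Coefficients commutativeRing
    using (solve; _:=_; _:+_; _:*_; _:-_; :-_; con)
  open TotalOrder totalOrder
    using (total; antisym; poset)
    renaming (refl to ≤-refl; trans to ≤-trans; reflexive to ≤-reflexive)
  open Exp commutativeSemiring using (^-assocʳ; ^-distrib-*)
  open PosetReasoning poset

  -- Splits an inequality into a sign condition on the gap and a ring identity for the solver.
  ≤-from-gap : ∀ {x y d} → 0# ≤ d → x + d ≈ y → x ≤ y
  ≤-from-gap {x} {y} {d} 0≤d x+d≈y = begin
    x       ≈⟨ solve 1 (λ x → x := con (+ 0) :+ x) refl x ⟩
    0# + x  ≤⟨ +-monoˡ-≤ x 0≤d ⟩
    d + x   ≈⟨ +-comm d x ⟩
    x + d   ≈⟨ x+d≈y ⟩
    y       ∎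

  x≤y⇒0≤y-x : ∀ {x y} → x ≤ y → 0# ≤ y - x
  x≤y⇒0≤y-x {x} {y} x≤y = begin
    0#     ≈⟨ -‿inverseʳ x ⟨
    x - x  ≤⟨ +-monoˡ-≤ (- x) x≤y ⟩
    y - x  ∎

  <-from-gap : ∀ {x y d} → 0# < d → x + d ≈ y → x < y
  <-from-gap {x} {y} {d} (0≤d , 0≉d) x+d≈y = ≤-from-gap 0≤d x+d≈y , λ x≈y → 0≉d (begin-equality
    0#       ≈⟨ -‿inverseʳ x ⟨
    x - x    ≈⟨ +-congʳ x≈y ⟩
    y - x    ≈⟨ +-congʳ x+d≈y ⟨
    x + d - x ≈⟨ solve 2 (λ x d → x :+ d :- x := d) refl x d ⟩
    d        ∎)

  x<y⇒0<y-x : ∀ {x y} → x < y → 0# < y - x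
  x<y⇒0<y-x {x} {y} (x≤y , x≉y) = x≤y⇒0≤y-x x≤y , λ 0≈y-x → x≉y (begin-equality
    x            ≈⟨ +-identityʳ x ⟨
    x + 0#       ≈⟨ +-congˡ 0≈y-x ⟩
    x + (y - x)  ≈⟨ solve 2 (λ x y → x :+ (y :- x) := y) refl x y ⟩
    y            ∎)

  <⇒≱ : ∀ {x y} → x < y → ¬ (y ≤ x)
  <⇒≱ (x≤y , x≉y) y≤x = x≉y (antisym x≤y y≤x)

  ≰⇒> : ∀ {x y} → ¬ (x ≤ y) → y < x
  ≰⇒> {x} {y} x≰y with total x y
  ... | inj₁ x≤y = ⊥-elim (x≰y x≤y)
  ... | inj₂ y≤x = y≤x , λ y≈x → x≰y (≤-reflexive (sym y≈x))

  +-monoʳ-≤ : ∀ z {x y} → x ≤ y → z + x ≤ z + y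
  +-monoʳ-≤ z {x} {y} x≤y = begin
    z + x  ≈⟨ +-comm z x ⟩
    x + z  ≤⟨ +-monoˡ-≤ z x≤y ⟩
    y + z  ≈⟨ +-comm y z ⟩
    z + y  ∎

  +-nonneg : ∀ {x y} → 0# ≤ x → 0# ≤ y → 0# ≤ x + y
  +-nonneg {x} {y} 0≤x 0≤y = begin
    0#      ≤⟨ 0≤x ⟩
    x       ≈⟨ +-identityʳ x ⟨
    x + 0#  ≤⟨ +-monoʳ-≤ x 0≤y ⟩
    x + y   ∎

  *-monoˡ-≤ : ∀ {z} → 0# ≤ z → ∀ {x y} → x ≤ y → x * z ≤ y * z
  *-monoˡ-≤ {z} 0≤z {x} {y} x≤y = ≤-from-gap (*-nonneg (x≤y⇒0≤y-x x≤y) 0≤z)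
    (solve 3 (λ x y z → x :* z :+ (y :- x) :* z := y :* z) refl x y z)

  *-monoʳ-≤ : ∀ {z} → 0# ≤ z → ∀ {x y} → x ≤ y → z * x ≤ z * y
  *-monoʳ-≤ {z} 0≤z {x} {y} x≤y = begin
    z * x  ≈⟨ *-comm z x ⟩
    x * z  ≤⟨ *-monoˡ-≤ 0≤z x≤y ⟩
    y * z  ≈⟨ *-comm y z ⟩
    z * y  ∎

  square-nonneg : ∀ x → 0# ≤ x * x
  square-nonneg x with total 0# x
  ... | inj₁ 0≤x = *-nonneg 0≤x 0≤x
  ... | inj₂ x≤0 = begin
    0#                    ≤⟨ *-nonneg (x≤y⇒0≤y-x x≤0) (x≤y⇒0≤y-x x≤0) ⟩
    (0# - x) * (0# - x)   ≈⟨ solve 1 (λ x → (con (+ 0) :- x) :* (con (+ 0) :- x) := x :* x) refl x ⟩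
    x * x                 ∎

  0≤1 : 0# ≤ 1#
  0≤1 = ≤-trans (square-nonneg 1#) (≤-reflexive (*-identityˡ 1#))

  0<1 : 0# < 1#
  0<1 = 0≤1 , 0≉1

  1≤⇒0< : ∀ {x} → 1# ≤ x → 0# < x
  1≤⇒0< 1≤x = ≰⇒> λ x≤0 → <⇒≱ 0<1 (≤-trans 1≤x x≤0)

  1≤1+x : ∀ {x} → 0# ≤ x → 1# ≤ 1# + x
  1≤1+x 0≤x = ≤-from-gap 0≤x refl

  *⁻¹-cancel : ∀ {x} → 0# < x → x * x ⁻¹ ≈ 1#
  *⁻¹-cancel (_ , 0≉x) = ⁻¹-inverseʳ _ λ x≈0 → 0≉x (sym x≈0)

  /-cancel : ∀ {y} → 0# < y → ∀ x → y * (x / y) ≈ x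
  /-cancel {y} 0<y x = begin-equality
    y * (x * y ⁻¹)  ≈⟨ solve 3 (λ y x i → y :* (x :* i) := x :* (y :* i)) refl y x (y ⁻¹) ⟩
    x * (y * y ⁻¹)  ≈⟨ *-congˡ (*⁻¹-cancel 0<y) ⟩
    x * 1#          ≈⟨ *-identityʳ x ⟩
    x               ∎

  ⁻¹-nonneg : ∀ {x} → 0# < x → 0# ≤ x ⁻¹
  ⁻¹-nonneg {x} 0<x with total 0# (x ⁻¹)
  ... | inj₁ 0≤x⁻¹ = 0≤x⁻¹
  ... | inj₂ x⁻¹≤0 = ⊥-elim (<⇒≱ 0<1 (begin
    1#            ≈⟨ *⁻¹-cancel 0<x ⟨
    x * x ⁻¹      ≤⟨ *-monoʳ-≤ (proj₁ 0<x) x⁻¹≤0 ⟩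
    x * 0#        ≈⟨ solve 1 (λ x → x :* con (+ 0) := con (+ 0)) refl x ⟩
    0#            ∎))

  /-nonneg : ∀ {x y} → 0# ≤ x → 0# < y → 0# ≤ x / y
  /-nonneg 0≤x 0<y = *-nonneg 0≤x (⁻¹-nonneg 0<y)

  -‿anti-≤ : ∀ {x y} → x ≤ y → - y ≤ - x
  -‿anti-≤ {x} {y} x≤y = ≤-from-gap (x≤y⇒0≤y-x x≤y)
    (solve 2 (λ x y → :- y :+ (y :- x) := :- x) refl x y)

  1≤x*y : ∀ {x y} → 1# ≤ x → 1# ≤ y → 1# ≤ x * y
  1≤x*y {x} {y} 1≤x 1≤y = begin
    1#      ≤⟨ 1≤x ⟩
    x       ≈⟨ *-identityʳ x ⟨
    x * 1#  ≤⟨ *-monoʳ-≤ (≤-trans 0≤1 1≤x) 1≤y ⟩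
    x * y   ∎

  1≤x/y : ∀ {x y} → 0# < y → y ≤ x → 1# ≤ x / y
  1≤x/y {x} {y} 0<y y≤x = begin
    1#     ≈⟨ *⁻¹-cancel 0<y ⟨
    y / y  ≤⟨ *-monoˡ-≤ (⁻¹-nonneg 0<y) y≤x ⟩
    x / y  ∎

  1≤x⇒x⁻¹≤1 : ∀ {x} → 1# ≤ x → x ⁻¹ ≤ 1#
  1≤x⇒x⁻¹≤1 {x} 1≤x = begin
    x ⁻¹       ≈⟨ *-identityˡ (x ⁻¹) ⟨
    1# * x ⁻¹  ≤⟨ *-monoˡ-≤ (⁻¹-nonneg (1≤⇒0< 1≤x)) 1≤x ⟩
    x * x ⁻¹   ≈⟨ *⁻¹-cancel (1≤⇒0< 1≤x) ⟩
    1#         ∎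

  x*y≤z⇒y≤z/x : ∀ {x y z} → 0# < x → x * y ≤ z → y ≤ z / x
  x*y≤z⇒y≤z/x {x} {y} {z} 0<x xy≤z = begin
    y              ≈⟨ /-cancel 0<x y ⟨
    x * (y / x)    ≈⟨ *-assoc x y (x ⁻¹) ⟨
    x * y / x      ≤⟨ *-monoˡ-≤ (⁻¹-nonneg 0<x) xy≤z ⟩
    z / x          ∎

  -- Per-step contraction and the final approximation bound.

  -- Multiplying the hypothesis by u = 1/c gives u (a - s) ≤ a - b, which is then subtracted from a
  -- - s. Here a and b are consecutive greedy values and s is the value to be approached.
  contraction : ∀ {a b s c u} → a - s ≤ c * (a - b) → 0# ≤ u → c * u ≈ 1# →
                b - s ≤ (1# - u) * (a - s)
  contraction {a} {b} {s} {c} {u} a-s≤c[a-b] 0≤u cu≈1 = begin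
    b - s
      ≤⟨ ≤-from-gap (*-nonneg 0≤u (x≤y⇒0≤y-x a-s≤c[a-b]))
           (solve 5 (λ a b s c u → b :- s :+ u :* (c :* (a :- b) :- (a :- s))
                     := b :- s :+ c :* u :* (a :- b) :- u :* (a :- s)) refl a b s c u) ⟩
    b - s + c * u * (a - b) - u * (a - s)
      ≈⟨ +-congʳ (+-congˡ (*-congʳ cu≈1)) ⟩
    b - s + 1# * (a - b) - u * (a - s)
      ≈⟨ solve 4 (λ a b s u → b :- s :+ con (+ 1) :* (a :- b) :- u :* (a :- s)
                  := (con (+ 1) :- u) :* (a :- s)) refl a b s u ⟩
    (1# - u) * (a - s) ∎

  -- Think of p as the decay factor (1 - u)^τ and of q as ρ/ε. Dropping -s from a₀ - s leaves the
  -- excess p ρ s = ε (q p) s, which is at most ε s.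
  approximation : ∀ {p q a a₀ s ρ ε} → 0# ≤ p → q * p ≤ 1# → 0# ≤ s → a₀ ≤ ρ * s →
                  ε * q ≈ ρ → 0# ≤ ε → a - s ≤ p * (a₀ - s) → a ≤ (1# + ε) * s
  approximation {p} {q} {a} {a₀} {s} {ρ} {ε} 0≤p qp≤1 0≤s a₀≤ρs εq≈ρ 0≤ε a-s≤ = begin
    a                         ≈⟨ solve 2 (λ a s → a := s :+ (a :- s)) refl a s ⟩
    s + (a - s)               ≤⟨ +-monoʳ-≤ s a-s≤ ⟩
    s + p * (a₀ - s)          ≤⟨ +-monoʳ-≤ s (*-monoʳ-≤ 0≤p (≤-from-gap 0≤s
                                   (solve 2 (λ a s → a :- s :+ s := a) refl a₀ s))) ⟩
    s + p * a₀                ≤⟨ +-monoʳ-≤ s (*-monoʳ-≤ 0≤p a₀≤ρs) ⟩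
    s + p * (ρ * s)           ≈⟨ +-congˡ (*-congˡ (*-congʳ εq≈ρ)) ⟨
    s + p * (ε * q * s)       ≈⟨ solve 4 (λ s p e q → s :+ p :* (e :* q :* s) := s :+ e :* (q :* p) :* s)
                                   refl s p ε q ⟩
    s + ε * (q * p) * s       ≤⟨ +-monoʳ-≤ s (*-monoˡ-≤ 0≤s (*-monoʳ-≤ 0≤ε qp≤1)) ⟩
    s + ε * 1# * s            ≈⟨ solve 2 (λ s e → s :+ e :* con (+ 1) :* s := (con (+ 1) :+ e) :* s)
                                   refl s ε ⟩
    (1# + ε) * s              ∎

  -- Arguments with arbitrarily small slack.

  *-bounded-below : ∀ {c δ} → 0# ≤ c → 0# < δ → ∃ λ η → 0# < η × η * c < δ
  *-bounded-below {c} {δ} 0≤c 0<δ = η , 0<η , <-from-gap 0<η η*c+η≈δ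
    where
    η : Carrier
    -- The divisor 1 + c is positive even for c = 0, and it makes η itself the gap between η c and
    -- δ.
    η = δ / (1# + c)

    η*c+η≈δ : η * c + η ≈ δ
    η*c+η≈δ = trans (solve 2 (λ e c → e :* c :+ e := (con (+ 1) :+ c) :* e) refl η c)
                    (/-cancel (1≤⇒0< (1≤1+x 0≤c)) δ)

    0<η : 0# < η
    0<η = /-nonneg (proj₁ 0<δ) (1≤⇒0< (1≤1+x 0≤c)) , λ 0≈η → proj₂ 0<δ (begin-equality
      0#            ≈⟨ solve 1 (λ c → con (+ 0) := con (+ 0) :* c :+ con (+ 0)) refl c ⟩
      0# * c + 0#   ≈⟨ +-cong (*-congʳ 0≈η) 0≈η ⟩
      η * c + η     ≈⟨ η*c+η≈δ ⟩
      δ             ∎)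

  -- If y < x, then some η > 0 has η c < x - y, against the assumption at that η. This replaces
  -- passing to the limit η → 0.
  ≤-from-slack : ∀ {c x y} → 0# ≤ c → (∀ η → 0# < η → x ≤ y + η * c) → x ≤ y
  ≤-from-slack {c} {x} {y} 0≤c x≤y+ηc with em {x ≤ y}
  ... | yes x≤y = x≤y
  ... | no  x≰y =
    let η , 0<η , ηc<x-y = *-bounded-below 0≤c (x<y⇒0<y-x (≰⇒> x≰y))
    in ⊥-elim (<⇒≱ ηc<x-y (begin
         x - y            ≤⟨ +-monoˡ-≤ (- y) (x≤y+ηc η 0<η) ⟩
         y + η * c - y    ≈⟨ solve 2 (λ y e → y :+ e :- y := e) refl y (η * c) ⟩
         η * c            ∎))

  -- Powers and Bernoulli-type inequalities.

  ^-nonneg : ∀ {x} → 0# ≤ x → ∀ n → 0# ≤ x ^ n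
  ^-nonneg 0≤x zero    = 0≤1
  ^-nonneg 0≤x (suc n) = *-nonneg 0≤x (^-nonneg 0≤x n)

  ^-monoˡ-≤ : ∀ {x y} → 0# ≤ x → x ≤ y → ∀ n → x ^ n ≤ y ^ n
  ^-monoˡ-≤ 0≤x x≤y zero = ≤-refl
  ^-monoˡ-≤ {x} {y} 0≤x x≤y (suc n) = begin
    x * x ^ n  ≤⟨ *-monoˡ-≤ (^-nonneg 0≤x n) x≤y ⟩
    y * x ^ n  ≤⟨ *-monoʳ-≤ (≤-trans 0≤x x≤y) (^-monoˡ-≤ 0≤x x≤y n) ⟩
    y * y ^ n  ∎

  x≤1⇒x^n≤1 : ∀ {x} → 0# ≤ x → x ≤ 1# → ∀ n → x ^ n ≤ 1#
  x≤1⇒x^n≤1 0≤x x≤1 zero = ≤-refl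
  x≤1⇒x^n≤1 {x} 0≤x x≤1 (suc n) = begin
    x * x ^ n  ≤⟨ *-monoʳ-≤ 0≤x (x≤1⇒x^n≤1 0≤x x≤1 n) ⟩
    x * 1#     ≈⟨ *-identityʳ x ⟩
    x          ≤⟨ x≤1 ⟩
    1#         ∎

  fromℕ-nonneg : ∀ n → 0# ≤ fromℕ n
  fromℕ-nonneg zero    = ≤-refl
  fromℕ-nonneg (suc n) = +-nonneg 0≤1 (fromℕ-nonneg n)

  1≤fromℕ-suc : ∀ n → 1# ≤ fromℕ (suc n)
  1≤fromℕ-suc n = 1≤1+x (fromℕ-nonneg n)

  0<fromℕ-suc : ∀ n → 0# < fromℕ (suc n)
  0<fromℕ-suc n = 1≤⇒0< (1≤fromℕ-suc n)

  fromℕ-mono-≤ : ∀ {m n} → m ℕ.≤ n → fromℕ m ≤ fromℕ n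
  fromℕ-mono-≤ {n = n} ℕ.z≤n = fromℕ-nonneg n
  fromℕ-mono-≤ (ℕ.s≤s m≤n)   = +-monoʳ-≤ 1# (fromℕ-mono-≤ m≤n)

  bernoulli : ∀ {v} → 0# ≤ v → ∀ n → 1# + fromℕ n * v ≤ (1# + v) ^ n
  bernoulli {v} 0≤v zero = ≤-reflexive (solve 1 (λ v → con (+ 1) :+ con (+ 0) :* v := con (+ 1)) refl v)
  bernoulli {v} 0≤v (suc n) = begin
    1# + (1# + N) * v              ≤⟨ ≤-from-gap (*-nonneg (fromℕ-nonneg n) (square-nonneg v))
                                        (solve 2 (λ N v → con (+ 1) :+ (con (+ 1) :+ N) :* v :+ N :* (v :* v)
                                                         := (con (+ 1) :+ v) :* (con (+ 1) :+ N :* v)) refl N v) ⟩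
    (1# + v) * (1# + N * v)        ≤⟨ *-monoʳ-≤ (+-nonneg 0≤1 0≤v) (bernoulli 0≤v n) ⟩
    (1# + v) * (1# + v) ^ n        ∎
    where
    N : Carrier
    N = fromℕ n

  -- One factor is absorbed at a time: (1 + v)(1 - (N + 1) v) = 1 - N v - (N + 1) v² ≤ 1 - N v. The
  -- product form stays valid when 1 - n v is negative.
  reverse-bernoulli : ∀ {v} → 0# ≤ v → ∀ n → (1# + v) ^ n * (1# - fromℕ n * v) ≤ 1#
  reverse-bernoulli {v} 0≤v zero =
    ≤-reflexive (solve 1 (λ v → con (+ 1) :* (con (+ 1) :- con (+ 0) :* v) := con (+ 1)) refl v)
  reverse-bernoulli {v} 0≤v (suc n) = begin
    (1# + v) * P * (1# - (1# + N) * v)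
      ≤⟨ ≤-from-gap (*-nonneg (^-nonneg (+-nonneg 0≤1 0≤v) n)
                              (*-nonneg (fromℕ-nonneg (suc n)) (square-nonneg v)))
           (solve 3 (λ P N v → (con (+ 1) :+ v) :* P :* (con (+ 1) :- (con (+ 1) :+ N) :* v)
                                 :+ P :* ((con (+ 1) :+ N) :* (v :* v))
                               := P :* (con (+ 1) :- N :* v)) refl P N v) ⟩
    P * (1# - N * v)
      ≤⟨ reverse-bernoulli 0≤v n ⟩
    1# ∎
    where
    N P : Carrier
    N = fromℕ n
    P = (1# + v) ^ n

  -- The convex function x ↦ x^(n+1) lies above its tangent at a.
  tangent : ∀ {a b} → 0# ≤ a → 0# ≤ b → ∀ n →
            fromℕ (suc n) * a ^ n * b ≤ b ^ suc n + fromℕ n * a ^ suc n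
  tangent {a} {b} 0≤a 0≤b zero =
    ≤-reflexive (solve 2 (λ a b → (con (+ 1) :+ con (+ 0)) :* con (+ 1) :* b
                                  := b :* con (+ 1) :+ con (+ 0) :* (a :* con (+ 1))) refl a b)
  tangent {a} {b} 0≤a 0≤b (suc n) = ≤-from-gap
    (+-nonneg (*-nonneg 0≤b (x≤y⇒0≤y-x (tangent 0≤a 0≤b n)))
              (*-nonneg (*-nonneg (fromℕ-nonneg (suc n)) (^-nonneg 0≤a n)) (square-nonneg (b - a))))
    (solve 5 (λ a b p q N →
        let 1+N = con (+ 1) :+ N in
        (con (+ 1) :+ 1+N) :* (a :* p) :* b
          :+ (b :* (b :* q :+ N :* (a :* p) :- 1+N :* p :* b)
              :+ 1+N :* p :* ((b :- a) :* (b :- a)))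
        := b :* (b :* q) :+ 1+N :* (a :* (a :* p)))
      refl a b (a ^ n) (b ^ n) (fromℕ n))

  -- The approximants (1 + y/n)^n of the exponential.

  -- The sequence whose limit defines `IsExp`. The bounds below are stated at `suc n`, because the
  -- inverse of `fromℕ 0` is unspecified.
  compound : Carrier → ℕ → Carrier
  compound y n = (1# + y / fromℕ n) ^ n

  base-nonneg : ∀ {y} → 0# ≤ y → ∀ n → 0# ≤ 1# + y / fromℕ (suc n)
  base-nonneg 0≤y n = +-nonneg 0≤1 (/-nonneg 0≤y (0<fromℕ-suc n))

  -- Apply `tangent` to x^(N+1) at a = 1 + y/N and evaluate at b = 1 + y/(N + 1). Since (N + 1) b -
  -- N a = 1, the tangent value (N + 1) a^N b - N a^(N+1) is exactly a^N.
  compound-step : ∀ {y} → 0# ≤ y → ∀ n → compound y (suc n) ≤ compound y (suc (suc n))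
  compound-step {y} 0≤y n = begin
    P
      ≈⟨ solve 3 (λ P N y → P := P :* (con (+ 1) :+ N :+ y) :- P :* (N :+ y)) refl P N y ⟩
    P * (1# + N + y) - P * (N + y)
      ≈⟨ +-cong (*-congˡ (+-congˡ (/-cancel (0<fromℕ-suc (suc n)) y)))
                (-‿cong (*-congˡ (+-congˡ (/-cancel (0<fromℕ-suc n) y)))) ⟨
    P * (1# + N + (1# + N) * (y / (1# + N))) - P * (N + N * (y / N))
      ≈⟨ solve 4 (λ P N v w → P :* (con (+ 1) :+ N :+ (con (+ 1) :+ N) :* w) :- P :* (N :+ N :* v)
                   := (con (+ 1) :+ N) :* P :* (con (+ 1) :+ w) :- N :* ((con (+ 1) :+ v) :* P))
           refl P N (y / N) (y / (1# + N)) ⟩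
    (1# + N) * P * b - N * (a * P)
      ≤⟨ +-monoˡ-≤ (- (N * (a * P))) (tangent (base-nonneg 0≤y n) (base-nonneg 0≤y (suc n)) (suc n)) ⟩
    b ^ suc (suc n) + N * (a * P) - N * (a * P)
      ≈⟨ solve 2 (λ x y → x :+ y :- y := x) refl (b ^ suc (suc n)) (N * (a * P)) ⟩
    b ^ suc (suc n)
      ∎
    where
    N a b P : Carrier
    N = fromℕ (suc n)
    a = 1# + y / N
    b = 1# + y / (1# + N)
    P = a ^ suc n

  compound-mono : ∀ {y} → 0# ≤ y → ∀ {m n} → m ℕ.≤′ n → compound y (suc m) ≤ compound y (suc n)
  compound-mono 0≤y (ℕ.≤′-reflexive ≡.refl)  = ≤-refl
  compound-mono 0≤y (ℕ.≤′-step {n = n} m≤′n) = ≤-trans (compound-mono 0≤y m≤′n) (compound-step 0≤y n)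

  -- `reverse-bernoulli` at v = y/m, with m = n + 1. It is the bound e^y (1 - y) ≤ 1, already valid
  -- for every approximant.
  compound-upper : ∀ {y} → 0# ≤ y → ∀ n → compound y (suc n) * (1# - y) ≤ 1#
  compound-upper {y} 0≤y n = begin
    compound y (suc n) * (1# - y)
      ≈⟨ *-congˡ (+-congˡ (-‿cong (/-cancel (0<fromℕ-suc n) y))) ⟨
    compound y (suc n) * (1# - fromℕ (suc n) * (y / fromℕ (suc n)))
      ≤⟨ reverse-bernoulli (/-nonneg 0≤y (0<fromℕ-suc n)) (suc n) ⟩
    1# ∎

  compound-nonneg : ∀ {y} → 0# ≤ y → ∀ n → 0# ≤ compound y (suc n)
  compound-nonneg 0≤y n = ^-nonneg (base-nonneg 0≤y n) (suc n)

  -- The bases satisfy (1 + y/m)(1 + z/m) = 1 + (y + z)/m + yz/m², so one half of the addition law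
  -- of the exponential holds before the limit.
  compound-+ : ∀ {y z} → 0# ≤ y → 0# ≤ z → ∀ n →
               compound (y + z) (suc n) ≤ compound y (suc n) * compound z (suc n)
  compound-+ {y} {z} 0≤y 0≤z n = begin
    compound (y + z) (suc n)
      ≤⟨ ^-monoˡ-≤ (base-nonneg (+-nonneg 0≤y 0≤z) n) (≤-from-gap
           (*-nonneg (/-nonneg 0≤y (0<fromℕ-suc n)) (/-nonneg 0≤z (0<fromℕ-suc n)))
           (solve 3 (λ y z i → con (+ 1) :+ (y :+ z) :* i :+ (y :* i) :* (z :* i)
                     := (con (+ 1) :+ y :* i) :* (con (+ 1) :+ z :* i)) refl y z (fromℕ (suc n) ⁻¹)))
           (suc n) ⟩
    ((1# + y / fromℕ (suc n)) * (1# + z / fromℕ (suc n))) ^ suc n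
      ≈⟨ ^-distrib-* _ _ (suc n) ⟩
    compound y (suc n) * compound z (suc n) ∎

  compound-monoˡ : ∀ {y z} → 0# ≤ y → y ≤ z → ∀ n → compound y (suc n) ≤ compound z (suc n)
  compound-monoˡ 0≤y y≤z n = ^-monoˡ-≤ (base-nonneg 0≤y n)
    (+-monoʳ-≤ 1# (*-monoˡ-≤ (⁻¹-nonneg (0<fromℕ-suc n)) y≤z)) (suc n)

  compound-lower : ∀ {y} → 0# ≤ y → ∀ n → 1# + y ≤ compound y (suc n)
  compound-lower {y} 0≤y n = begin
    1# + y                                      ≈⟨ +-congˡ (/-cancel (0<fromℕ-suc n) y) ⟨
    1# + fromℕ (suc n) * (y / fromℕ (suc n))    ≤⟨ bernoulli (/-nonneg 0≤y (0<fromℕ-suc n)) (suc n) ⟩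
    compound y (suc n)                          ∎

  -- For η > 1 the left side is at most 0, so the proof of such a bound may assume 0 ≤ 1 - η and
  -- multiply by that factor.
  *[1-]-≤ : ∀ {w v η} → 0# ≤ w → 0# ≤ v → (0# ≤ 1# - η → w * (1# - η) ≤ v) → w * (1# - η) ≤ v
  *[1-]-≤ {w} {v} {η} 0≤w 0≤v w*[1-η]≤v with total 0# (1# - η)
  ... | inj₁ 0≤1-η = w*[1-η]≤v 0≤1-η
  ... | inj₂ 1-η≤0 = begin
    w * (1# - η)  ≤⟨ *-monoʳ-≤ 0≤w 1-η≤0 ⟩
    w * 0#        ≈⟨ zeroʳ w ⟩
    0#            ≤⟨ 0≤v ⟩
    v             ∎

  -- Continuity in the exponent, uniform in n: raising z by η multiplies an approximant by at most
  -- `compound η (suc n)`, and the factor 1 - η cancels that growth.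
  compound-close : ∀ {y z η} → 0# ≤ y → 0# ≤ z → 0# ≤ η → y ≤ z + η → ∀ n →
                   compound y (suc n) * (1# - η) ≤ compound z (suc n)
  compound-close {y} {z} {η} 0≤y 0≤z 0≤η y≤z+η n =
    *[1-]-≤ (compound-nonneg 0≤y n) (compound-nonneg 0≤z n) λ 0≤1-η → begin
    compound y (suc n) * (1# - η)
      ≤⟨ *-monoˡ-≤ 0≤1-η (≤-trans (compound-monoˡ 0≤y y≤z+η n) (compound-+ 0≤z 0≤η n)) ⟩
    compound z (suc n) * compound η (suc n) * (1# - η)
      ≈⟨ *-assoc _ _ _ ⟩
    compound z (suc n) * (compound η (suc n) * (1# - η))
      ≤⟨ *-monoʳ-≤ (compound-nonneg 0≤z n) (compound-upper 0≤η n) ⟩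
    compound z (suc n) * 1#
      ≈⟨ *-identityʳ _ ⟩
    compound z (suc n) ∎

  -- Suprema, the Archimedean property and ceilings.

  ≰-minus : ∀ {x y} → 0# < y → ¬ (x ≤ x - y)
  ≰-minus {x} {y} 0<y = <⇒≱ (<-from-gap 0<y (solve 2 (λ x y → x :- y :+ y := x) refl x y))

  +≤⇒≤- : ∀ {x y z} → x + y ≤ z → x ≤ z - y
  +≤⇒≤- {x} {y} {z} x+y≤z = begin
    x          ≈⟨ solve 2 (λ x y → x := x :+ y :- y) refl x y ⟩
    x + y - y  ≤⟨ +-monoˡ-≤ (- y) x+y≤z ⟩
    z - y      ∎

  -- If no member came within η of s, then s - η would be a smaller upper bound.
  supremum-approx : ∀ {P : Pred Carrier 0ℓ} {s} → (∀ u → UpperBound P u → s ≤ u) →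
                    ∀ {η} → 0# < η → ∃ λ y → P y × s ≤ y + η
  supremum-approx {P} {s} least {η} 0<η with em {∃ λ y → P y × s ≤ y + η}
  ... | yes close = close
  ... | no  ¬close = ⊥-elim (≰-minus 0<η (least (s - η) bound))
    where
    bound : UpperBound P (s - η)
    bound y Py with total s (y + η)
    ... | inj₁ s≤y+η = ⊥-elim (¬close (y , Py , s≤y+η))
    ... | inj₂ y+η≤s = +≤⇒≤- y+η≤s

  -- If x bounded all naturals, they would have a supremum s. As n + 1 ≤ s for every n, s - 1 would
  -- be an upper bound too, contradicting leastness.
  archimedean : ∀ x → ∃ λ n → x ≤ fromℕ n
  archimedean x with em {∃ λ n → x ≤ fromℕ n}
  ... | yes bounded = bounded
  ... | no  ¬bounded = ⊥-elim (≰-minus 0<1 (least (s - 1#) s-1-bound))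
    where
    IsNatural : Pred Carrier 0ℓ
    IsNatural r = ∃ λ n → fromℕ n ≡ r

    x-bound : UpperBound IsNatural x
    x-bound _ (n , ≡.refl) = proj₁ (≰⇒> λ x≤n → ¬bounded (n , x≤n))

    sup : ∃ λ s → UpperBound IsNatural s × (∀ u → UpperBound IsNatural u → s ≤ u)
    sup = supremum IsNatural (0# , 0 , ≡.refl) (x , x-bound)

    s : Carrier
    s = proj₁ sup

    least : ∀ u → UpperBound IsNatural u → s ≤ u
    least = proj₂ (proj₂ sup)

    s-1-bound : UpperBound IsNatural (s - 1#)
    s-1-bound _ (n , ≡.refl) = +≤⇒≤-
      (≤-trans (≤-reflexive (+-comm (fromℕ n) 1#)) (proj₁ (proj₂ sup) _ (suc n , ≡.refl)))

  -- Descent from an Archimedean bound: either a smaller natural is still above x, or the current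
  -- one is least.
  ceiling-exists : ∀ x → ∃ (IsCeiling x)
  ceiling-exists x = let n , x≤n = archimedean x in search n x≤n
    where
    search : ∀ n → x ≤ fromℕ n → ∃ (IsCeiling x)
    search = <-rec _ go
      where
      go : ∀ n → (∀ {m} → m ℕ.< n → x ≤ fromℕ m → ∃ (IsCeiling x)) → x ≤ fromℕ n → ∃ (IsCeiling x)
      go n smaller x≤n with em {∃ λ m → m ℕ.< n × x ≤ fromℕ m}
      ... | yes (m , m<n , x≤m) = smaller m<n x≤m
      ... | no  minimal = n , x≤n , λ m x≤m → ℕ.≮⇒≥ λ m<n → minimal (m , m<n , x≤m)

  -- Logarithms of x ≥ 1 and the decay bound they give.

  ≤-from-shrunk : ∀ {x y η} → x * (1# - η) ≤ y → x ≤ y + η * x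
  ≤-from-shrunk {x} {y} {η} x[1-η]≤y = begin
    x                     ≈⟨ solve 2 (λ x e → x := x :* (con (+ 1) :- e) :+ e :* x) refl x η ⟩
    x * (1# - η) + η * x  ≤⟨ +-monoˡ-≤ (η * x) x[1-η]≤y ⟩
    y + η * x             ∎

  minus-<-minus : ∀ {x y z δ} → x ≤ y + z → z < δ → - δ < y - x
  minus-<-minus {x} {y} {z} {δ} x≤y+z z<δ = ≰⇒> λ y-x≤-δ → <⇒≱ z<δ (≤-from-gap
    (+-nonneg (x≤y⇒0≤y-x x≤y+z) (x≤y⇒0≤y-x y-x≤-δ))
    (solve 4 (λ x y z δ → δ :+ (y :+ z :- x :+ (:- δ :- (y :- x))) := z) refl x y z δ))

  minus-< : ∀ {x y δ} → y ≤ x → 0# < δ → y - x < δ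
  minus-< {x} {y} {δ} y≤x 0<δ = ≰⇒> λ δ≤y-x → <⇒≱ 0<δ (begin
    δ      ≤⟨ δ≤y-x ⟩
    y - x  ≤⟨ +-monoˡ-≤ (- x) y≤x ⟩
    x - x  ≈⟨ -‿inverseʳ x ⟩
    0#     ∎)

  compound-0 : ∀ n → compound 0# (suc n) ≤ 1#
  compound-0 n = x≤1⇒x^n≤1 (base-nonneg ≤-refl n)
    (≤-reflexive (trans (+-congˡ (zeroˡ _)) (+-identityʳ 1#))) (suc n)

  -- The upper half of convergence is immediate. For the lower half, pick η with η x < δ: beyond the
  -- N for s + η monotonicity keeps x below the approximants at s + η, and lowering the exponent to
  -- s costs only the factor 1 - η.
  supremum-IsExp : ∀ {x s} → 0# ≤ x → 0# ≤ s →
    (∀ n → compound s (suc n) ≤ x) →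
    (∀ η → 0# < η → ∃ λ N → x ≤ compound (s + η) (suc N)) →
    IsExp s x
  supremum-IsExp {x} {s} 0≤x 0≤s below above δ 0<δ with *-bounded-below 0≤x 0<δ
  ... | η , 0<η , ηx<δ with above η 0<η
  -- The threshold `suc N` forces the index to be a successor, where the approximants are
  -- controlled.
  ... | N , x≤ = suc N , λ { (suc n) (ℕ.s≤s N≤n) →
    minus-<-minus {y = compound s (suc n)} (≤-from-shrunk (lower n N≤n)) ηx<δ
    , minus-< {y = compound s (suc n)} (below n) 0<δ }
    where
    0≤s+η : 0# ≤ s + η
    0≤s+η = +-nonneg 0≤s (proj₁ 0<η)

    lower : ∀ n → N ℕ.≤ n → x * (1# - η) ≤ compound s (suc n)
    lower n N≤n = *[1-]-≤ 0≤x (compound-nonneg 0≤s n) λ 0≤1-η → begin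
      x * (1# - η)
        ≤⟨ *-monoˡ-≤ 0≤1-η (≤-trans x≤ (compound-mono 0≤s+η (ℕ.≤⇒≤′ N≤n))) ⟩
      compound (s + η) (suc n) * (1# - η)
        ≤⟨ compound-close 0≤s+η 0≤s (proj₁ 0<η) ≤-refl n ⟩
      compound s (suc n) ∎

  CompoundsBelow : Carrier → Pred Carrier 0ℓ
  CompoundsBelow x y = 0# ≤ y × (∀ n → compound y (suc n) ≤ x)

  0-compoundsBelow : ∀ {x} → 1# ≤ x → CompoundsBelow x 0#
  0-compoundsBelow 1≤x = ≤-refl , λ n → ≤-trans (compound-0 n) 1≤x

  compoundsBelow-bound : ∀ {x} → UpperBound (CompoundsBelow x) x
  compoundsBelow-bound {x} y (0≤y , y-below) = begin
    y              ≤⟨ ≤-from-gap 0≤1 (+-comm y 1#) ⟩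
    1# + y         ≤⟨ compound-lower 0≤y 0 ⟩
    compound y 1   ≤⟨ y-below 0 ⟩
    x              ∎

  log-exists : ∀ {x} → 1# ≤ x → ∃ λ y → IsExp y x
  log-exists {x} 1≤x
    with supremum (CompoundsBelow x) (0# , 0-compoundsBelow 1≤x) (x , compoundsBelow-bound)
  ... | s , s-bound , s-least = s , supremum-IsExp (≤-trans 0≤1 1≤x) 0≤s below above
    where
    0≤s : 0# ≤ s
    0≤s = s-bound 0# (0-compoundsBelow 1≤x)

    -- Membership of s itself is not given by its being a supremum; it is reached from members y
    -- within η of s.
    below : ∀ n → compound s (suc n) ≤ x
    below n = ≤-from-slack (compound-nonneg 0≤s n) λ η 0<η →
      let y , (0≤y , y-below) , s≤y+η = supremum-approx s-least 0<η
      in ≤-from-shrunk {compound s (suc n)} (≤-trans (compound-close 0≤s 0≤y (proj₁ 0<η) s≤y+η n) (y-below n))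

    -- Otherwise s + η would compound below x and exceed its own upper bound s.
    above : ∀ η → 0# < η → ∃ λ N → x ≤ compound (s + η) (suc N)
    above η 0<η with em {∃ λ N → x ≤ compound (s + η) (suc N)}
    ... | yes above = above
    ... | no  ¬above = ⊥-elim (<⇒≱ (<-from-gap 0<η refl) (s-bound (s + η)
      (+-nonneg 0≤s (proj₁ 0<η) , λ n → proj₁ (≰⇒> λ x≤ → ¬above (n , x≤)))))

  -- For large m, 1 + y/m ≤ (1 + u/m)^τ turns the claim for the approximant of x into ((1 + u/m)^m
  -- (1 - u))^τ ≤ 1. The slack η pays for replacing x by that approximant.
  IsExp-upper : ∀ {x y u τ} → 0# ≤ u → u ≤ 1# → y ≤ fromℕ τ * u → IsExp y x →
                x * (1# - u) ^ τ ≤ 1#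
  IsExp-upper {x} {y} {u} {τ} 0≤u u≤1 y≤τu y-log = ≤-from-slack 0≤A λ η 0<η →
    let N , close = y-log η 0<η
        M , -y≤M  = archimedean (- y)
        -- Beyond N the approximant is within η of x. Beyond M ≥ -y the base 1 + y/(n + 1) is
        -- non-negative, as comparing powers requires.
        n         = N ℕ.+ M
        w         = compound y (suc n)
    in begin
      x * A            ≤⟨ *-monoˡ-≤ 0≤A (≤-from-gap
                            (x≤y⇒0≤y-x (proj₁ (proj₁ (close (suc n) (ℕ.m≤n⇒m≤1+n (ℕ.m≤m+n N M))))))
                            (solve 3 (λ x e w → x :+ (w :- x :- :- e) := w :+ e) refl x η w)) ⟩
      (w + η) * A      ≈⟨ solve 3 (λ w e A → (w :+ e) :* A := w :* A :+ e :* A) refl w η A ⟩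
      w * A + η * A    ≤⟨ +-monoˡ-≤ (η * A) (w*A≤1 n (≤-trans -y≤M (fromℕ-mono-≤ (ℕ.m≤n⇒m≤1+n (ℕ.m≤n+m M N))))) ⟩
      1# + η * A       ∎
    where
    A : Carrier
    A = (1# - u) ^ τ

    0≤1-u : 0# ≤ 1# - u
    0≤1-u = x≤y⇒0≤y-x u≤1

    0≤A : 0# ≤ A
    0≤A = ^-nonneg 0≤1-u τ

    w*A≤1 : ∀ n → - y ≤ fromℕ (suc n) → compound y (suc n) * A ≤ 1#
    w*A≤1 n -y≤n = begin
      (1# + y / ν) ^ suc n * A
        ≤⟨ *-monoˡ-≤ 0≤A (^-monoˡ-≤ 0≤base base≤ (suc n)) ⟩
      ((1# + u / ν) ^ τ) ^ suc n * A
        ≈⟨ *-congʳ ^-swap ⟩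
      compound u (suc n) ^ τ * A
        ≈⟨ ^-distrib-* (compound u (suc n)) (1# - u) τ ⟨
      (compound u (suc n) * (1# - u)) ^ τ
        ≤⟨ x≤1⇒x^n≤1 (*-nonneg (compound-nonneg 0≤u n) 0≤1-u) (compound-upper 0≤u n) τ ⟩
      1# ∎
      where
      ν : Carrier
      ν = fromℕ (suc n)

      0≤ν⁻¹ : 0# ≤ ν ⁻¹
      0≤ν⁻¹ = ⁻¹-nonneg (0<fromℕ-suc n)

      0≤base : 0# ≤ 1# + y / ν
      0≤base = begin
        0#                ≤⟨ *-nonneg (x≤y⇒0≤y-x -y≤n) 0≤ν⁻¹ ⟩
        (ν - - y) / ν     ≈⟨ solve 3 (λ ν y i → (ν :- :- y) :* i := ν :* i :+ y :* i) refl ν y (ν ⁻¹) ⟩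
        ν / ν + y / ν     ≈⟨ +-congʳ (*⁻¹-cancel (0<fromℕ-suc n)) ⟩
        1# + y / ν        ∎

      base≤ : 1# + y / ν ≤ (1# + u / ν) ^ τ
      base≤ = begin
        1# + y / ν              ≤⟨ +-monoʳ-≤ 1# (*-monoˡ-≤ 0≤ν⁻¹ y≤τu) ⟩
        1# + fromℕ τ * u / ν    ≈⟨ +-congˡ (*-assoc _ _ _) ⟩
        1# + fromℕ τ * (u / ν)  ≤⟨ bernoulli (*-nonneg 0≤u 0≤ν⁻¹) τ ⟩
        (1# + u / ν) ^ τ        ∎

      ^-swap : ((1# + u / ν) ^ τ) ^ suc n ≈ compound u (suc n) ^ τ
      ^-swap = begin-equality
        ((1# + u / ν) ^ τ) ^ suc n    ≈⟨ ^-assocʳ _ τ (suc n) ⟩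
        (1# + u / ν) ^ (τ ℕ.* suc n)  ≡⟨ ≡.cong ((1# + u / ν) ^_) (ℕ.*-comm τ (suc n)) ⟩
        (1# + u / ν) ^ (suc n ℕ.* τ)  ≈⟨ ^-assocʳ _ (suc n) τ ⟨
        ((1# + u / ν) ^ suc n) ^ τ    ∎

-- Definite description and sizes of unions.

-- Transfers existence proofs to `ln` and `⌈_⌉`: with a witness at hand, the default branch is
-- contradictory.
the-satisfies : (em : ExcludedMiddle 0ℓ) {A : Set} {P : Pred A 0ℓ} (default : A) →
                ∃ P → P (the em P default)
the-satisfies em {P = P} default p with em {∃ P}
... | yes (_ , Px) = Px
... | no  ¬p       = ⊥-elim (¬p p)

∣p∪q∣≤∣p∣+∣q∣ : ∀ {n} (p q : Subset n) → ∣ p ∪ q ∣ ℕ.≤ ∣ p ∣ ℕ.+ ∣ q ∣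
∣p∪q∣≤∣p∣+∣q∣ []            []            = ℕ.z≤n
∣p∪q∣≤∣p∣+∣q∣ (outside ∷ p) (outside ∷ q) = ∣p∪q∣≤∣p∣+∣q∣ p q
∣p∪q∣≤∣p∣+∣q∣ (outside ∷ p) (inside  ∷ q) =
  ≡.subst (suc ∣ p ∪ q ∣ ℕ.≤_) (≡.sym (ℕ.+-suc ∣ p ∣ ∣ q ∣)) (ℕ.s≤s (∣p∪q∣≤∣p∣+∣q∣ p q))
∣p∪q∣≤∣p∣+∣q∣ (inside  ∷ p) (y       ∷ q) =
  ℕ.s≤s (ℕ.≤-trans (∣p∪q∣≤∣p∣+∣q∣ p q) (ℕ.+-monoʳ-≤ ∣ p ∣ (∣p∣≤∣x∷p∣ y q)))

∣p∪⁅i⁆∣≤1+∣p∣ : ∀ {n} (p : Subset n) (i : Fin n) → ∣ p ∪ ⁅ i ⁆ ∣ ℕ.≤ suc ∣ p ∣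
∣p∪⁅i⁆∣≤1+∣p∣ p i = ≡.subst (∣ p ∪ ⁅ i ⁆ ∣ ℕ.≤_)
  (≡.trans (≡.cong (∣ p ∣ ℕ.+_) (∣⁅x⁆∣≡1 i)) (ℕ.+-comm ∣ p ∣ 1)) (∣p∪q∣≤∣p∣+∣q∣ p ⁅ i ⁆)

-- Greedy runs: existence, size and decay.

module Greedy (em : ExcludedMiddle 0ℓ) (ℝ : Reals) {n : ℕ} where
  open Reals ℝ
  open SetFunctions ℝ
  open OrderedField em ℝ
  open CommutativeRing commutativeRing using (refl; *-assoc)
  open ℤ-Coefficients commutativeRing using (solve; _:=_; _:+_; _:*_; con)
  open TotalOrder totalOrder using (poset) renaming (refl to ≤-refl)
  open Extrema totalOrder using (argmin; f[argmin]≤f[xs]; max≤v⁺)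
  open PosetReasoning poset hiding (start)

  argMin-exists : .{{NonZero n}} → (g : Fin n → Carrier) → ∃ (IsArgMin g)
  argMin-exists g = argmin g i₀ (allFin n) , λ j → All.lookup (f[argmin]≤f[xs] i₀ (allFin n)) (∈-allFin j)
    where
    i₀ : Fin n
    i₀ = fromℕ< (ℕ.>-nonZero⁻¹ n)

  module _ (f : SetFunction n) where

    greedy-exists : .{{NonZero n}} → ∀ S₀ t → ∃ λ S → GreedyExtension f S₀ t S
    greedy-exists S₀ zero = S₀ , start
    greedy-exists S₀ (suc t) =
      let S , run   = greedy-exists S₀ t
          i , i-min = argMin-exists (λ j → f (S ∪ ⁅ j ⁆))
      in S ∪ ⁅ i ⁆ , step run i i-min

    greedy-⊇ : ∀ {S₀ t S} → GreedyExtension f S₀ t S → S₀ ⊆ S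
    greedy-⊇ start          = ⊆-refl
    greedy-⊇ (step run i _) = ⊆-trans (greedy-⊇ run) (p⊆p∪q ⁅ i ⁆)

    -- Only an inequality, since a step may choose an element already present.
    greedy-size : ∀ {S₀ t S} → GreedyExtension f S₀ t S → ∣ S ∣ ℕ.≤ ∣ S₀ ∣ ℕ.+ t
    greedy-size {S₀} start = ℕ.≤-reflexive (≡.sym (ℕ.+-identityʳ ∣ S₀ ∣))
    greedy-size {S₀} (step {t} {S} run i _) = ℕ.≤-trans (∣p∪⁅i⁆∣≤1+∣p∣ S i)
      (≡.subst (suc ∣ S ∣ ℕ.≤_) (≡.sym (ℕ.+-suc ∣ S₀ ∣ t)) (ℕ.s≤s (greedy-size run)))

    -- The condition 0 ≤ v covers the empty list, where `maximum` is zero by convention.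
    maximum-≤ : ∀ {v} → 0# ≤ v → (xs : List Carrier) → All (_≤ v) xs → maximum xs ≤ v
    maximum-≤ 0≤v []       []         = 0≤v
    maximum-≤ 0≤v (x ∷ xs) (x≤v ∷ xs≤v) = max≤v⁺ x≤v xs≤v

    module _ (decreasing : NonIncreasing f) where

      -- Monotonicity gives f (S ∪ T) ≤ f T, so weak supermodularity bounds f S - f T as well. Every
      -- single-element gain is at most the greedy one, because i minimises over all of `Fin n`;
      -- this gain is non-negative, so ∣T ─ S∣ may be raised to k.
      greedy-gain : ∀ {α} → 0# ≤ α → WeaklySupermodular α f →
        ∀ {k} (S T : Subset n) → ∣ T ∣ ℕ.≤ k →
        ∀ i → IsArgMin (λ j → f (S ∪ ⁅ j ⁆)) i →
        f S - f T ≤ α * fromℕ k * (f S - f (S ∪ ⁅ i ⁆))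
      greedy-gain {α} 0≤α supermodular {k} S T ∣T∣≤k i i-min = begin
        f S - f T
          ≤⟨ +-monoʳ-≤ (f S) (-‿anti-≤ fS∪T≤fT) ⟩
        f S - f (S ∪ T)
          ≤⟨ supermodular S T ⟩
        α * fromℕ ∣ T ─ S ∣ * maximum gains
          ≤⟨ *-monoʳ-≤ (*-nonneg 0≤α (fromℕ-nonneg ∣ T ─ S ∣)) gains≤ ⟩
        α * fromℕ ∣ T ─ S ∣ * (f S - f (S ∪ ⁅ i ⁆))
          ≤⟨ *-monoˡ-≤ 0≤gain (*-monoʳ-≤ 0≤α (fromℕ-mono-≤ (ℕ.≤-trans (∣p─q∣≤∣p∣ T S) ∣T∣≤k))) ⟩
        α * fromℕ k * (f S - f (S ∪ ⁅ i ⁆))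
          ∎
        where
        gains : List Carrier
        gains = map (λ j → f S - f (S ∪ ⁅ j ⁆)) (elements (T ─ S))

        fS∪T≤fT : f (S ∪ T) ≤ f T
        fS∪T≤fT = ≡.subst (λ U → f U ≤ f T) (∪-comm T S) (decreasing T S)

        0≤gain : 0# ≤ f S - f (S ∪ ⁅ i ⁆)
        0≤gain = x≤y⇒0≤y-x (decreasing S ⁅ i ⁆)

        gains≤ : maximum gains ≤ f S - f (S ∪ ⁅ i ⁆)
        gains≤ = maximum-≤ 0≤gain gains
          (All.map⁺ (All.universal (λ j → +-monoʳ-≤ (f S) (-‿anti-≤ (i-min j))) (elements (T ─ S))))

      -- Each step of the run contributes one factor 1 - u through `contraction`. The difference f S
      -- - f T may be negative, as S can outgrow k elements; the multiplication relies on 0 ≤ 1 - u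
      -- alone.
      greedy-decay : ∀ {α} → 0# ≤ α → WeaklySupermodular α f →
        ∀ {k T} → ∣ T ∣ ℕ.≤ k → ∀ {u} → 0# ≤ u → u ≤ 1# → α * fromℕ k * u ≈ 1# →
        ∀ {S₀ t S} → GreedyExtension f S₀ t S →
        f S - f T ≤ (1# - u) ^ t * (f S₀ - f T)
      greedy-decay 0≤α sm ∣T∣≤k 0≤u u≤1 cu≈1 {S₀} start =
        ≤-from-gap ≤-refl (solve 1 (λ d → d :+ con (+ 0) := con (+ 1) :* d) refl _)
      greedy-decay {α} 0≤α sm {k} {T} ∣T∣≤k {u} 0≤u u≤1 cu≈1 {S₀} (step {t} {S} run i i-min) = begin
        f S′ - f T
          ≤⟨ contraction (greedy-gain 0≤α sm S T ∣T∣≤k i i-min) 0≤u cu≈1 ⟩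
        (1# - u) * (f S - f T)
          ≤⟨ *-monoʳ-≤ (x≤y⇒0≤y-x u≤1) (greedy-decay 0≤α sm ∣T∣≤k 0≤u u≤1 cu≈1 run) ⟩
        (1# - u) * ((1# - u) ^ t * (f S₀ - f T))
          ≈⟨ *-assoc _ _ _ ⟨
        (1# - u) ^ suc t * (f S₀ - f T)
          ∎
        where
        S′ : Subset n
        S′ = S ∪ ⁅ i ⁆

theorem2 :
    (em : ExcludedMiddle 0ℓ) (ℝ : Reals) →
    let open Reals ℝ
        open RealFunctions em ℝ
        open SetFunctions ℝ
    in
    (n : ℕ) .{{_ : NonZero n}}
    (α : Carrier) → 1# ≤ α →
    (f : SetFunction n) →
    NonNegative f → NonIncreasing f → WeaklySupermodular α f →
    (k : ℕ) .{{_ : NonZero k}}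
    (S* : Subset n) → IsOptimal f k S* →
    (ρ : Carrier) → 1# ≤ ρ →
    (S₀ : Subset n) → f S₀ ≤ ρ * f S* →
    (ε : Carrier) → 0# < ε → ε ≤ ρ →
    let τ = ⌈ α * fromℕ k * ln (ρ / ε) ⌉ in
    (∃ λ S → GreedyExtension f S₀ τ S) ×
    (∀ S → GreedyExtension f S₀ τ S →
      S₀ ⊆ S × ∣ S ∣ ℕ.≤ ∣ S₀ ∣ ℕ.+ τ × f S ≤ (1# + ε) * f S*)
theorem2 em ℝ n α 1≤α f nonNegative nonIncreasing supermodular k@(suc k-1) S* (∣S*∣≤k , _)
         ρ 1≤ρ S₀ fS₀≤ρfS* ε 0<ε ε≤ρ =
  greedy-exists f S₀ τ ,
  λ S run → greedy-⊇ f run , greedy-size f run ,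
    -- The decay factor is (1 - u)^τ, and ρ/ε plays the part of q.
    approximation 0≤1-u^τ x[1-u]^τ≤1 (nonNegative S*) fS₀≤ρfS* (/-cancel 0<ε ρ) (proj₁ 0<ε)
      (greedy-decay f nonIncreasing 0≤α supermodular ∣S*∣≤k 0≤u u≤1 (*⁻¹-cancel 0<c) run)
  where
  open Reals ℝ
  open RealFunctions em ℝ
  open OrderedField em ℝ
  open Greedy em ℝ
  open TotalOrder totalOrder using () renaming (trans to ≤-trans)

  c u y : Carrier
  c = α * fromℕ k
  u = c ⁻¹
  y = ln (ρ / ε)

  τ : ℕ
  τ = ⌈ c * y ⌉

  0≤α : 0# ≤ α
  0≤α = ≤-trans 0≤1 1≤α

  1≤c : 1# ≤ c
  1≤c = 1≤x*y 1≤α (1≤fromℕ-suc k-1)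

  0<c : 0# < c
  0<c = 1≤⇒0< 1≤c

  0≤u : 0# ≤ u
  0≤u = ⁻¹-nonneg 0<c

  u≤1 : u ≤ 1#
  u≤1 = 1≤x⇒x⁻¹≤1 1≤c

  0≤1-u^τ : 0# ≤ (1# - u) ^ τ
  0≤1-u^τ = ^-nonneg (x≤y⇒0≤y-x u≤1) τ

  x[1-u]^τ≤1 : ρ / ε * (1# - u) ^ τ ≤ 1#
  x[1-u]^τ≤1 = IsExp-upper {τ = τ} 0≤u u≤1
    -- The ceiling gives c y ≤ τ, and `fromℕ τ / c` unfolds to `fromℕ τ * u`.
    (x*y≤z⇒y≤z/x 0<c (proj₁ (the-satisfies em 0 (ceiling-exists (c * y)))))
    -- From ε ≤ ρ comes ρ/ε ≥ 1, so `ln` returns a true logarithm here and not its default.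
    (the-satisfies em 0# (log-exists (1≤x/y 0<ε ε≤ρ)))
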